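{- Every Boolean doctrine over a small category embeds into a first-order Boolean doctrine. That is: for every small category $\mathsf{C}$ with finite products and every functor $\mathbf{P}\colon\mathsf{C}^{\mathrm{op}}\to\mathsf{BA}$ there are a first-order Boolean doctrine $\mathbf{H}\colon\mathsf{C}^{\mathrm{op}}\to\mathsf{BA}$ and a natural transformation $\mathbf{P}\to\mathbf{H}$ all of whose components are injective.
   Context: $\mathsf{BA}$ is the category of Boolean algebras and Boolean homomorphisms. A Boolean doctrine over a category $\mathsf{C}$ with finite products is a functor $\mathbf{P}\colon\mathsf{C}^{\mathrm{op}}\to\mathsf{BA}$. It is a first-order Boolean doctrine if (i) for all $X,Y\in\mathsf{C}$, with $\mathrm{pr}_1\colon X\times Y\to X$ the projection, the map $\mathbf{P}(\mathrm{pr}_1)\colon\mathbf{P}(X)\to\mathbf{P}(X\times Y)$ has a right adjoint $(\forall Y)_X$ as an order-preserving map, i.e. $\alpha\le(\forall Y)_X\beta\iff\mathbf{P}(\mathrm{pr}_1)(\alpha)\le\beta$; and (ii) (Beck-Chevalley) for every $f\colon X'\to X$ and every $Y$ in $\mathsf{C}$, $\mathbf{P}(f)\circ(\forall Y)_X=(\forall Y)_{X'}\circ\mathbf{P}(f\times\mathrm{id}_Y)$. An embedding of Boolean doctrines over the same base category is a componentwise injective natural transformation. -}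

module Defs where

open import Level using (Level; _⊔_; suc)
open import Function.Base using (id; _∘_)
open import Function.Definitions using (Injective)
open import Relation.Binary.Core using (Rel)
open import Relation.Binary.Structures using (IsEquivalence)
open import Relation.Binary.Bundles using (Poset)
open import Relation.Binary.Definitions using (Adjoint)
open import Relation.Binary.Morphism.Bundles using (PosetHomomorphism)
open import Algebra.Lattice.Bundles using (BooleanAlgebra)
open import Algebra.Lattice.Morphism.Structures using (IsLatticeHomomorphism)
import Algebra.Lattice.Morphism.Construct.Identity as Identity
import Algebra.Lattice.Morphism.Construct.Composition as Composition
import Algebra.Lattice.Properties.Lattice as LatticeProperties

-- Hom-sets are setoids, as are the Boolean algebras of the standard
-- library: equality of morphisms (of elements) is the given _≈_.  Objects
-- are never compared for equality.

record Category (o h e : Level) : Set (suc (o ⊔ h ⊔ e)) where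
  infix  4 _≈_
  infixr 9 _∘ᶜ_
  field
    Obj     : Set o
    Hom     : Obj → Obj → Set h
    _≈_     : ∀ {X Y} → Rel (Hom X Y) e
    idᶜ     : ∀ {X} → Hom X X
    _∘ᶜ_    : ∀ {X Y Z} → Hom Y Z → Hom X Y → Hom X Z
    isEquivalence : ∀ {X Y} → IsEquivalence (_≈_ {X} {Y})
    ∘-cong  : ∀ {X Y Z} {f f′ : Hom Y Z} {g g′ : Hom X Y} →
              f ≈ f′ → g ≈ g′ → f ∘ᶜ g ≈ f′ ∘ᶜ g′
    identityˡ : ∀ {X Y} (f : Hom X Y) → idᶜ ∘ᶜ f ≈ f
    identityʳ : ∀ {X Y} (f : Hom X Y) → f ∘ᶜ idᶜ ≈ f
    assoc   : ∀ {W X Y Z} (f : Hom Y Z) (g : Hom X Y) (k : Hom W X) →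
              (f ∘ᶜ g) ∘ᶜ k ≈ f ∘ᶜ (g ∘ᶜ k)

infix 10 _ᵒᵖ

_ᵒᵖ : ∀ {o h e} → Category o h e → Category o h e
C ᵒᵖ = record
  { Obj           = Obj
  ; Hom           = λ X Y → Hom Y X
  ; _≈_           = _≈_
  ; idᶜ           = idᶜ
  ; _∘ᶜ_          = λ f g → g ∘ᶜ f
  ; isEquivalence = isEquivalence
  ; ∘-cong        = λ p q → ∘-cong q p
  ; identityˡ     = identityʳ
  ; identityʳ     = identityˡ
  ; assoc         = λ f g k → IsEquivalence.sym isEquivalence (assoc k g f)
  }
  where open Category C

record Functor {o h e o′ h′ e′ : Level}
               (C : Category o h e) (D : Category o′ h′ e′)
               : Set (o ⊔ h ⊔ e ⊔ o′ ⊔ h′ ⊔ e′) where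
  private
    module C = Category C
    module D = Category D
  field
    F₀     : C.Obj → D.Obj
    F₁     : ∀ {X Y} → C.Hom X Y → D.Hom (F₀ X) (F₀ Y)
    F-cong : ∀ {X Y} {f g : C.Hom X Y} → f C.≈ g → F₁ f D.≈ F₁ g
    F-id   : ∀ {X} → F₁ (C.idᶜ {X}) D.≈ D.idᶜ
    F-∘    : ∀ {X Y Z} (f : C.Hom Y Z) (g : C.Hom X Y) →
             F₁ (f C.∘ᶜ g) D.≈ F₁ f D.∘ᶜ F₁ g

record NaturalTransformation {o h e o′ h′ e′ : Level}
                             {C : Category o h e} {D : Category o′ h′ e′}
                             (F G : Functor C D)
                             : Set (o ⊔ h ⊔ h′ ⊔ e′) where
  private
    module C = Category C
    module D = Category D
    module F = Functor F
    module G = Functor G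
  field
    η       : ∀ X → D.Hom (F.F₀ X) (G.F₀ X)
    natural : ∀ {X Y} (f : C.Hom X Y) →
              η Y D.∘ᶜ F.F₁ f D.≈ G.F₁ f D.∘ᶜ η X

record FiniteProducts {o h e : Level} (C : Category o h e)
                      : Set (o ⊔ h ⊔ e) where
  open Category C
  infixr 7 _×ᶜ_
  field
    𝟙        : Obj
    !        : ∀ {X} → Hom X 𝟙
    !-unique : ∀ {X} (f : Hom X 𝟙) → f ≈ !

    _×ᶜ_     : Obj → Obj → Obj
    pr₁      : ∀ {X Y} → Hom (X ×ᶜ Y) X
    pr₂      : ∀ {X Y} → Hom (X ×ᶜ Y) Y
    ⟨_,_⟩    : ∀ {X Y Z} → Hom Z X → Hom Z Y → Hom Z (X ×ᶜ Y)
    pr₁-β    : ∀ {X Y Z} (f : Hom Z X) (g : Hom Z Y) → pr₁ ∘ᶜ ⟨ f , g ⟩ ≈ f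
    pr₂-β    : ∀ {X Y Z} (f : Hom Z X) (g : Hom Z Y) → pr₂ ∘ᶜ ⟨ f , g ⟩ ≈ g
    ⟨⟩-unique : ∀ {X Y Z} (f : Hom Z X) (g : Hom Z Y) (k : Hom Z (X ×ᶜ Y)) →
                pr₁ ∘ᶜ k ≈ f → pr₂ ∘ᶜ k ≈ g → k ≈ ⟨ f , g ⟩

  infixr 8 _×id_
  _×id_ : ∀ {X′ X} → Hom X′ X → (Y : Obj) → Hom (X′ ×ᶜ Y) (X ×ᶜ Y)
  f ×id Y = ⟨ f ∘ᶜ pr₁ , pr₂ ⟩

record BooleanHomomorphism {c ℓ c′ ℓ′ : Level}
                           (A : BooleanAlgebra c ℓ) (B : BooleanAlgebra c′ ℓ′)
                           : Set (c ⊔ ℓ ⊔ c′ ⊔ ℓ′) where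
  private
    module A = BooleanAlgebra A
    module B = BooleanAlgebra B
  field
    ⟦_⟧                   : A.Carrier → B.Carrier
    isLatticeHomomorphism : IsLatticeHomomorphism A.rawLattice B.rawLattice ⟦_⟧
    ⊤-homo                : ⟦ A.⊤ ⟧ B.≈ B.⊤
    ⊥-homo                : ⟦ A.⊥ ⟧ B.≈ B.⊥
    ¬-homo                : ∀ x → ⟦ A.¬ x ⟧ B.≈ B.¬ ⟦ x ⟧

  open IsLatticeHomomorphism isLatticeHomomorphism public

open BooleanHomomorphism using (⟦_⟧)

BA : (ℓ : Level) → Category (suc ℓ) ℓ ℓ
BA ℓ = record
  { Obj           = BooleanAlgebra ℓ ℓ
  ; Hom           = BooleanHomomorphism
  ; _≈_           = λ {A} {B} f g → ∀ x → BooleanAlgebra._≈_ B (⟦ f ⟧ x) (⟦ g ⟧ x)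
  ; idᶜ           = λ {A} → idᴮ A
  ; _∘ᶜ_          = _∘ᴮ_
  ; isEquivalence = λ {A} {B} → record
    { refl  = λ x → BooleanAlgebra.refl B
    ; sym   = λ p x → BooleanAlgebra.sym B (p x)
    ; trans = λ p q x → BooleanAlgebra.trans B (p x) (q x)
    }
  ; ∘-cong        = λ {_} {_} {Z} {f} {_} {_} {g′} p q x →
      BooleanAlgebra.trans Z (BooleanHomomorphism.⟦⟧-cong f (q x)) (p (⟦ g′ ⟧ x))
  ; identityˡ     = λ {_} {B} f x → BooleanAlgebra.refl B
  ; identityʳ     = λ {_} {B} f x → BooleanAlgebra.refl B
  ; assoc         = λ {_} {_} {_} {Z} f g k x → BooleanAlgebra.refl Z
  }
  where
  idᴮ : (A : BooleanAlgebra ℓ ℓ) → BooleanHomomorphism A A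
  idᴮ A = record
    { ⟦_⟧                   = id
    ; isLatticeHomomorphism = Identity.isLatticeHomomorphism rawLattice refl
    ; ⊤-homo                = refl
    ; ⊥-homo                = refl
    ; ¬-homo                = λ x → refl
    }
    where open BooleanAlgebra A

  _∘ᴮ_ : {X Y Z : BooleanAlgebra ℓ ℓ} →
         BooleanHomomorphism Y Z → BooleanHomomorphism X Y → BooleanHomomorphism X Z
  _∘ᴮ_ {Z = Z} f g = record
    { ⟦_⟧                   = ⟦ f ⟧ ∘ ⟦ g ⟧
    ; isLatticeHomomorphism = Composition.isLatticeHomomorphism trans
                                G.isLatticeHomomorphism F.isLatticeHomomorphism
    ; ⊤-homo                = trans (F.⟦⟧-cong G.⊤-homo) F.⊤-homo
    ; ⊥-homo                = trans (F.⟦⟧-cong G.⊥-homo) F.⊥-homo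
    ; ¬-homo                = λ x → trans (F.⟦⟧-cong (G.¬-homo x)) (F.¬-homo (⟦ g ⟧ x))
    }
    where
    open BooleanAlgebra Z using (trans)
    module F = BooleanHomomorphism f
    module G = BooleanHomomorphism g

-- The standard library's order on a lattice: x ≤ y is x ≈ x ∧ y.
order : ∀ {c ℓ} → BooleanAlgebra c ℓ → Poset c ℓ ℓ
order A = LatticeProperties.poset (BooleanAlgebra.lattice A)

-- Smallness of the base is relative to the universe level ℓ of the Boolean
-- algebras in BA ℓ.
BooleanDoctrine : ∀ {ℓ} → Category ℓ ℓ ℓ → Set (suc ℓ)
BooleanDoctrine {ℓ} C = Functor (C ᵒᵖ) (BA ℓ)

-- Right adjoints between posets are unique up to _≈_, so ∀′ carries no
-- information beyond its existence.
record IsFirstOrder {ℓ : Level} {C : Category ℓ ℓ ℓ} (products : FiniteProducts C)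
                    (P : BooleanDoctrine C) : Set ℓ where
  open Category C using (Obj; Hom)
  open FiniteProducts products
  open Functor P using () renaming (F₀ to P₀; F₁ to P₁)

  field
    ∀′ : (Y X : Obj) → PosetHomomorphism (order (P₀ (X ×ᶜ Y))) (order (P₀ X))

  ∀[_]_ : (Y : Obj) {X : Obj} →
          BooleanAlgebra.Carrier (P₀ (X ×ᶜ Y)) → BooleanAlgebra.Carrier (P₀ X)
  ∀[ Y ] β = PosetHomomorphism.⟦_⟧ (∀′ Y _) β

  field
    adjoint : (Y X : Obj) →
              Adjoint (Poset._≤_ (order (P₀ X))) (Poset._≤_ (order (P₀ (X ×ᶜ Y))))
                      ⟦ P₁ (pr₁ {X} {Y}) ⟧ (∀[ Y ]_)

    beck-chevalley : ∀ {X′ X} (f : Hom X′ X) (Y : Obj)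
                     (β : BooleanAlgebra.Carrier (P₀ (X ×ᶜ Y))) →
                     BooleanAlgebra._≈_ (P₀ X′)
                       (⟦ P₁ f ⟧ (∀[ Y ] β))
                       (∀[ Y ] (⟦ P₁ (f ×id Y) ⟧ β))

IsEmbedding : ∀ {ℓ} {C : Category ℓ ℓ ℓ} {P H : BooleanDoctrine C} →
              NaturalTransformation P H → Set ℓ
IsEmbedding {C = C} {P} {H} ι = (X : Category.Obj C) →
  Injective (BooleanAlgebra._≈_ (Functor.F₀ P X)) (BooleanAlgebra._≈_ (Functor.F₀ H X))
            ⟦ NaturalTransformation.η ι X ⟧

{-# OPTIONS --safe #-}

-- Cohen forcing with the doctrine as its own supply of conditions.  A
-- condition over X is an object W with an element w of P W and a generalized
-- element x : W → X; the atom α holds there when w ≤ P x α.  It is refined by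
-- passing to some W′ → W and shrinking w, and it is inconsistent when w is ⊥.
-- Every formula is then stable under double negation, so formulas modulo
-- being forced by the same conditions form Boolean algebras, and ∀ is the
-- right Kan extension of forcing along the projection.  The condition
-- (X, α, id) forces the atom β only if α ≤ β, whence atoms embed P.
-- Working with formulas instead of sets of conditions keeps carriers in Set ℓ.

module Submission where

open import Defs
open import Level using (Level; _⊔_)
open import Data.Product using (Σ-syntax; _×_; _,_; proj₁; proj₂)
open import Algebra.Core using (Op₁; Op₂)
open import Algebra.Lattice.Bundles using (BooleanAlgebra)
open import Algebra.Lattice.Structures.Biased using (isBooleanAlgebraʳ)
import Algebra.Lattice.Properties.BooleanAlgebra as BooleanProperties
open import Relation.Binary.Bundles using (Poset)
open import Relation.Binary.Structures using (IsEquivalence)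
open import Relation.Binary.Construct.Interior.Symmetric as Interior
  using (SymInterior; _,_)
open import Relation.Binary.Lattice
  using (Supremum; Lattice; MeetSemilattice; HeytingAlgebra)
import Relation.Binary.Lattice.Properties.Lattice as LatticeProperties
import Relation.Binary.Lattice.Properties.HeytingAlgebra as HeytingProperties
import Relation.Binary.Lattice.Properties.DistributiveLattice as DistributiveProperties
open import Relation.Binary.Morphism.Bundles using (mkPosetHomo)
import Relation.Binary.Reasoning.Setoid as ≈-Reasoning
open BooleanHomomorphism using (⟦_⟧)

-- Boolean algebras from meets and an involutive negation

record InvolutiveNegation {c ℓ₁ ℓ₂} (M : MeetSemilattice c ℓ₁ ℓ₂) : Set (c ⊔ ℓ₂) where
  open MeetSemilattice M
  infix 8 ¬_
  field
    ¬_       : Op₁ Carrier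
    ⊥        : Carrier
    ¬-intro  : ∀ {x y} → x ∧ y ≤ ⊥ → x ≤ ¬ y
    ¬-elim   : ∀ {x y} → x ≤ y → x ≤ ¬ y → x ≤ ⊥
    ¬¬-elim  : ∀ {x} → ¬ ¬ x ≤ x

  infixr 6 _∨_
  -- Forcing has no clause for disjunction, so joins are the de Morgan duals of meets.
  _∨_ : Op₂ Carrier
  x ∨ y = ¬ (¬ x ∧ ¬ y)

  ⊥-min : ∀ x → ⊥ ≤ x
  ⊥-min x = trans (¬-intro (x∧y≤x ⊥ (¬ x))) ¬¬-elim

  by-contradiction : ∀ {x y} → x ∧ ¬ y ≤ ⊥ → x ≤ y
  by-contradiction p = trans (¬-intro p) ¬¬-elim

  ¬-antitone : ∀ {x y} → x ≤ y → ¬ y ≤ ¬ x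
  ¬-antitone x≤y = ¬-intro (¬-elim (trans (x∧y≤y _ _) x≤y) (x∧y≤x _ _))

  supremum : Supremum _≤_ _∨_
  supremum x y =
    ¬-intro (¬-elim (x∧y≤x _ _) (trans (x∧y≤y _ _) (x∧y≤x _ _))) ,
    ¬-intro (¬-elim (x∧y≤x _ _) (trans (x∧y≤y _ _) (x∧y≤y _ _))) ,
    λ z x≤z y≤z → trans (¬-antitone (∧-greatest (¬-antitone x≤z) (¬-antitone y≤z))) ¬¬-elim

  -- The detour through Heyting algebras yields both distributive laws: meeting with an element has
  -- a right adjoint, hence preserves joins.
  heytingAlgebra : HeytingAlgebra c ℓ₁ ℓ₂
  heytingAlgebra = record
    { _∧_ = _∧_
    ; _∨_ = _∨_
    ; _⇨_ = λ x y → ¬ (x ∧ ¬ y)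
    ; ⊤ = ¬ ⊥
    ; ⊥ = ⊥
    ; isHeytingAlgebra = record
      { isBoundedLattice = record
        { isLattice = record
          { isPartialOrder = isPartialOrder
          ; supremum = supremum
          ; infimum = infimum
          }
        ; maximum = λ x → ¬-intro (x∧y≤y x ⊥)
        ; minimum = ⊥-min
        }
      ; exponential = λ w x y →
          (λ w∧x≤y → ¬-intro (¬-elim
             (trans (∧-greatest (x∧y≤x _ _) (trans (x∧y≤y _ _) (x∧y≤x _ _))) w∧x≤y)
             (trans (x∧y≤y _ _) (x∧y≤y _ _)))) ,
          (λ w≤x⇨y → by-contradiction (¬-elim
             (∧-greatest (trans (x∧y≤x _ _) (x∧y≤y _ _)) (x∧y≤y _ _))
             (trans (x∧y≤x _ _) (trans (x∧y≤x _ _) w≤x⇨y))))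
      }
    }

  open HeytingProperties heytingAlgebra using (distributiveLattice)
  open LatticeProperties (HeytingAlgebra.lattice heytingAlgebra) using (isAlgLattice)
  open DistributiveProperties distributiveLattice using (∨-distrib-∧; ∧-distrib-∨)

  booleanAlgebra : BooleanAlgebra c ℓ₁
  booleanAlgebra = record
    { _∨_ = _∨_
    ; _∧_ = _∧_
    ; ¬_ = ¬_
    ; ⊤ = ¬ ⊥
    ; ⊥ = ⊥
    ; isBooleanAlgebra = isBooleanAlgebraʳ record
      { isDistributiveLattice = record
        { isLattice = isAlgLattice
        ; ∨-distrib-∧ = ∨-distrib-∧
        ; ∧-distrib-∨ = ∧-distrib-∨
        }
      ; ∨-complementʳ = λ x → antisym (¬-intro (x∧y≤y _ ⊥))
          (¬-intro (¬-elim (trans (x∧y≤y _ _) (x∧y≤x _ _)) (trans (x∧y≤y _ _) (x∧y≤y _ _))))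
      ; ∧-complementʳ = λ x → antisym (¬-elim (x∧y≤x _ _) (x∧y≤y _ _)) (⊥-min _)
      ; ¬-cong = λ x≈y →
          antisym (¬-antitone (reflexive (Eq.sym x≈y))) (¬-antitone (reflexive x≈y))
      }
    }

  ≤⇒order : ∀ {x y} → x ≤ y → Poset._≤_ (order booleanAlgebra) x y
  ≤⇒order x≤y = antisym (∧-greatest refl x≤y) (x∧y≤x _ _)

  order⇒≤ : ∀ {x y} → Poset._≤_ (order booleanAlgebra) x y → x ≤ y
  order⇒≤ x≈x∧y = trans (reflexive x≈x∧y) (x∧y≤y _ _)

-- Order-theoretic reasoning in a Boolean algebra

module BooleanOrder {c ℓ} (B : BooleanAlgebra c ℓ) where
  open BooleanAlgebra B using (_∧_; _∨_; ¬_; ⊤; ⊥; _≈_; sym; ∧-congˡ;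
    ∧-complementʳ; ∨-complementʳ; ∧-distribˡ-∨) public
  open BooleanProperties B using (∧-identityʳ; ¬-involutive)
  open Lattice (BooleanProperties.∨-∧-orderTheoreticLattice B) using
    (_≤_; refl; trans; antisym; reflexive; x∧y≤x; x∧y≤y; ∧-greatest; ∨-least) public

  ¬-elim : ∀ {x y} → x ≤ y → x ≤ ¬ y → x ≤ ⊥
  ¬-elim x≤y x≤¬y = trans (∧-greatest x≤y x≤¬y) (reflexive (∧-complementʳ _))

  by-contradiction : ∀ {x y} → x ∧ ¬ y ≤ ⊥ → x ≤ y
  by-contradiction {x} {y} x∧¬y≤⊥ = trans (reflexive x≈) (∨-least (x∧y≤y x y) (trans x∧¬y≤⊥ ⊥≤y))
    where
    open ≈-Reasoning (BooleanAlgebra.setoid B)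

    x≈ : x ≈ x ∧ y ∨ x ∧ ¬ y
    x≈ = begin
      x                ≈⟨ ∧-identityʳ x ⟨
      x ∧ ⊤            ≈⟨ ∧-congˡ (∨-complementʳ y) ⟨
      x ∧ (y ∨ ¬ y)    ≈⟨ ∧-distribˡ-∨ x y (¬ y) ⟩
      x ∧ y ∨ x ∧ ¬ y  ∎

    ⊥≤y : ⊥ ≤ y
    ⊥≤y = trans (reflexive (sym (∧-complementʳ y))) (x∧y≤x y (¬ y))

  ¬-intro : ∀ {x y} → x ∧ y ≤ ⊥ → x ≤ ¬ y
  ¬-intro x∧y≤⊥ = by-contradiction (trans
    (∧-greatest (x∧y≤x _ _) (trans (x∧y≤y _ _) (reflexive (¬-involutive _)))) x∧y≤⊥)

-- Boolean homomorphisms from meets and complements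

module _ {c ℓ c′ ℓ′} (A : BooleanAlgebra c ℓ) (B : BooleanAlgebra c′ ℓ′) where
  private
    module A where
      open BooleanAlgebra A public
      open BooleanProperties A public
    module B where
      open BooleanAlgebra B public
      open BooleanProperties B public

  -- Meet and complement determine the rest: joins by de Morgan, and the bounds as `x ∨ ¬ x` and
  -- `x ∧ ¬ x`.
  booleanHomomorphism :
    (f : A.Carrier → B.Carrier) →
    (∀ {x y} → x A.≈ y → f x B.≈ f y) →
    (∀ x y → f (x A.∧ y) B.≈ f x B.∧ f y) →
    (∀ x → f (A.¬ x) B.≈ B.¬ f x) →
    BooleanHomomorphism A B
  booleanHomomorphism f cong ∧-homo ¬-homo = record
    { ⟦_⟧ = f
    ; isLatticeHomomorphism = record
      { isRelHomomorphism = record { cong = cong }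
      ; ∧-homo = ∧-homo
      ; ∨-homo = ∨-homo
      }
    ; ⊤-homo = begin
        f A.⊤                    ≈⟨ cong (A.∨-complementʳ A.⊤) ⟨
        f (A.⊤ A.∨ A.¬ A.⊤)      ≈⟨ ∨-homo A.⊤ (A.¬ A.⊤) ⟩
        f A.⊤ B.∨ f (A.¬ A.⊤)    ≈⟨ B.∨-congˡ (¬-homo A.⊤) ⟩
        f A.⊤ B.∨ B.¬ f A.⊤      ≈⟨ B.∨-complementʳ (f A.⊤) ⟩
        B.⊤                      ∎
    ; ⊥-homo = begin
        f A.⊥                    ≈⟨ cong (A.∧-complementʳ A.⊥) ⟨
        f (A.⊥ A.∧ A.¬ A.⊥)      ≈⟨ ∧-homo A.⊥ (A.¬ A.⊥) ⟩
        f A.⊥ B.∧ f (A.¬ A.⊥)    ≈⟨ B.∧-congˡ (¬-homo A.⊥) ⟩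
        f A.⊥ B.∧ B.¬ f A.⊥      ≈⟨ B.∧-complementʳ (f A.⊥) ⟩
        B.⊥                      ∎
    ; ¬-homo = ¬-homo
    }
    where
    open ≈-Reasoning B.setoid

    ∨-homo : ∀ x y → f (x A.∨ y) B.≈ f x B.∨ f y
    ∨-homo x y = begin
      f (x A.∨ y)                          ≈⟨ cong (A.¬-involutive (x A.∨ y)) ⟨
      f (A.¬ A.¬ (x A.∨ y))                ≈⟨ ¬-homo (A.¬ (x A.∨ y)) ⟩
      B.¬ f (A.¬ (x A.∨ y))                ≈⟨ B.¬-cong (cong (A.deMorgan₂ x y)) ⟩
      B.¬ f (A.¬ x A.∧ A.¬ y)              ≈⟨ B.¬-cong (∧-homo (A.¬ x) (A.¬ y)) ⟩
      B.¬ (f (A.¬ x) B.∧ f (A.¬ y))        ≈⟨ B.¬-cong (B.∧-cong (¬-homo x) (¬-homo y)) ⟩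
      B.¬ (B.¬ f x B.∧ B.¬ f y)            ≈⟨ B.¬-cong (B.deMorgan₂ (f x) (f y)) ⟨
      B.¬ B.¬ (f x B.∨ f y)                ≈⟨ B.¬-involutive (f x B.∨ f y) ⟩
      f x B.∨ f y                          ∎

module Forcing {ℓ : Level} (C : Category ℓ ℓ ℓ) (products : FiniteProducts C)
               (P : BooleanDoctrine C) where

  open Category C
  open FiniteProducts products
  private
    module ≈ {X Y} = IsEquivalence (isEquivalence {X} {Y})
    module P = Functor P
    module Pred {X : Obj} = BooleanOrder (P.F₀ X)
  open Pred using (_≤_)

  -- Reindexing in the given doctrine

  ∣P∣ : Obj → Set ℓ
  ∣P∣ X = BooleanAlgebra.Carrier (P.F₀ X)

  infixl 9 _[_]
  _[_] : ∀ {X Y} → ∣P∣ Y → Hom X Y → ∣P∣ X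
  α [ f ] = ⟦ P.F₁ f ⟧ α

  module _ {X Y : Obj} (f : Hom X Y) where
    private module f* = BooleanHomomorphism (P.F₁ f)

    []-cong : ∀ {α β} → α Pred.≈ β → α [ f ] Pred.≈ β [ f ]
    []-cong = f*.⟦⟧-cong

    []-mono : ∀ {α β} → α ≤ β → α [ f ] ≤ β [ f ]
    []-mono α≤β = BooleanAlgebra.trans (P.F₀ X) ([]-cong α≤β) (f*.∧-homo _ _)

    []-∧ : ∀ α β → (α Pred.∧ β) [ f ] Pred.≈ α [ f ] Pred.∧ β [ f ]
    []-∧ = f*.∧-homo

    []-¬ : ∀ α → (Pred.¬ α) [ f ] Pred.≈ Pred.¬ (α [ f ])
    []-¬ = f*.¬-homo

    []-⊥ : Pred.⊥ [ f ] Pred.≈ Pred.⊥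
    []-⊥ = f*.⊥-homo

  []-id : ∀ {X} (α : ∣P∣ X) → α [ idᶜ ] Pred.≈ α
  []-id = P.F-id

  []-∘ : ∀ {X Y Z} {h : Hom X Z} {f : Hom Y Z} {g : Hom X Y} (α : ∣P∣ Z) →
         h ≈ f ∘ᶜ g → α [ h ] Pred.≈ α [ f ] [ g ]
  []-∘ {X} α h≈fg = BooleanAlgebra.trans (P.F₀ X) (P.F-cong h≈fg α) (P.F-∘ _ _ α)

  -- Formulas and forcing conditions

  infix 8 ~_
  infixr 7 _&_
  -- Substitution is a formal constructor, interpreted by forcing. It never has to be computed under
  -- quantifiers, and its laws hold up to mutual entailment.
  data Form : Obj → Set ℓ where
    atom : ∀ {X} → ∣P∣ X → Form X
    ⊥′   : ∀ {X} → Form X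
    _&_  : ∀ {X} → Form X → Form X → Form X
    ~_   : ∀ {X} → Form X → Form X
    all  : ∀ {X} (Y : Obj) → Form (X ×ᶜ Y) → Form X
    sub  : ∀ {X′ X} → Hom X′ X → Form X → Form X′

  record Condition (X : Obj) : Set ℓ where
    constructor cond
    field
      {stage} : Obj
      truth   : ∣P∣ stage
      point   : Hom stage X
  open Condition

  infix 4 _≼_
  record _≼_ {X : Obj} (t s : Condition X) : Set ℓ where
    constructor refine
    field
      map      : Hom (stage t) (stage s)
      stronger : truth t ≤ truth s [ map ]
      over     : point t ≈ point s ∘ᶜ map

  -- Such conditions are not discarded; they force every formula. A negation therefore concludes
  -- with inconsistency instead of the empty type.
  Inconsistent : ∀ {X} → Condition X → Set ℓ
  Inconsistent s = truth s ≤ Pred.⊥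

  strengthen : ∀ {X W} {x y : Hom W X} {v w : ∣P∣ W} → v ≤ w → x ≈ y → cond v x ≼ cond w y
  strengthen v≤w x≈y = refine idᶜ
    (Pred.trans v≤w (Pred.reflexive (Pred.sym ([]-id _))))
    (≈.trans x≈y (≈.sym (identityʳ _)))

  ≼-refl : ∀ {X} {s : Condition X} → s ≼ s
  ≼-refl = strengthen Pred.refl ≈.refl

  ≼-trans : ∀ {X} {s t u : Condition X} → u ≼ t → t ≼ s → u ≼ s
  ≼-trans (refine g u≤tg u≈tg) (refine f t≤sf t≈sf) = refine (f ∘ᶜ g)
    (Pred.trans u≤tg (Pred.trans ([]-mono g t≤sf) (Pred.reflexive (Pred.sym ([]-∘ _ ≈.refl)))))
    (≈.trans u≈tg (≈.trans (∘-cong t≈sf ≈.refl) (assoc _ _ _)))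

  push : ∀ {X′ X} → Hom X′ X → Condition X′ → Condition X
  push f (cond w x) = cond w (f ∘ᶜ x)

  push-mono : ∀ {X′ X} (f : Hom X′ X) {s t : Condition X′} → t ≼ s → push f t ≼ push f s
  push-mono f (refine g t≤sg t≈sg) =
    refine g t≤sg (≈.trans (∘-cong ≈.refl t≈sg) (≈.sym (assoc _ _ _)))

  module _ {X′ X} (f : Hom X′ X) (s : Condition X′) {t : Condition X} (t≼fs : t ≼ push f s) where
    open _≼_ t≼fs

    -- Every refinement `t` of a pushed condition comes from a refinement of the original one: keep
    -- the truth of `t` and route its point through `s`. The truth being unchanged, `lift` is
    -- inconsistent exactly when `t` is.
    lift : Condition X′
    lift = cond (truth t) (point s ∘ᶜ map)

    lift-≼ : lift ≼ s
    lift-≼ = refine map stronger ≈.refl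

    push-lift-≼ : push f lift ≼ t
    push-lift-≼ = strengthen Pred.refl (≈.sym (≈.trans over (assoc _ _ _)))

  -- Forcing, its monotonicity and its stability

  infix 4 _⊩_
  _⊩_ : ∀ {X} → Condition X → Form X → Set ℓ
  s ⊩ atom α  = truth s ≤ α [ point s ]
  s ⊩ ⊥′      = Inconsistent s
  s ⊩ φ & ψ   = s ⊩ φ × s ⊩ ψ
  s ⊩ ~ φ     = ∀ t → t ≼ s → t ⊩ φ → Inconsistent t
  -- Since the projection of `t` need only refine `s`, this clause is monotone by transitivity
  -- alone.
  s ⊩ all Y φ = ∀ t → push pr₁ t ≼ s → t ⊩ φ
  s ⊩ sub f φ = push f s ⊩ φ

  ⊩-mono : ∀ {X} (φ : Form X) {s t : Condition X} → t ≼ s → s ⊩ φ → t ⊩ φ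
  ⊩-mono (atom α) (refine g t≤sg t≈sg) s≤α =
    Pred.trans t≤sg (Pred.trans ([]-mono g s≤α) (Pred.reflexive (Pred.sym ([]-∘ α t≈sg))))
  ⊩-mono ⊥′ (refine g t≤sg _) s≤⊥ =
    Pred.trans t≤sg (Pred.trans ([]-mono g s≤⊥) (Pred.reflexive ([]-⊥ g)))
  ⊩-mono (φ & ψ) t≼s (sφ , sψ) = ⊩-mono φ t≼s sφ , ⊩-mono ψ t≼s sψ
  ⊩-mono (~ φ) t≼s s~φ u u≼t = s~φ u (≼-trans u≼t t≼s)
  ⊩-mono (all Y φ) t≼s s∀φ u u≼t = s∀φ u (≼-trans u≼t t≼s)
  ⊩-mono (sub f φ) t≼s = ⊩-mono φ (push-mono f t≼s)

  ⊩-stable : ∀ {X} (φ : Form X) {s : Condition X} → s ⊩ ~ ~ φ → s ⊩ φ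
  ⊩-stable (atom α) {cond w x} s~~α = Pred.by-contradiction
    -- The part of `w` outside `α [ x ]` forces `~ atom α`, so stability makes it inconsistent.
    (s~~α (cond (w Pred.∧ Pred.¬ (α [ x ])) x) (strengthen (Pred.x∧y≤x _ _) ≈.refl)
      λ { u (refine g u≤tg u≈tg) u≤α → Pred.¬-elim
            (Pred.trans u≤α (Pred.reflexive ([]-∘ α u≈tg)))
            (Pred.trans u≤tg (Pred.trans ([]-mono g (Pred.x∧y≤y _ _)) (Pred.reflexive ([]-¬ g _)))) })
  ⊩-stable ⊥′ s~~⊥ = s~~⊥ _ ≼-refl λ _ _ u≤⊥ → u≤⊥
  ⊩-stable (φ & ψ) s~~φψ =
    ⊩-stable φ (λ t t≼s t~φ → s~~φψ t t≼s λ u u≼t (uφ , _) → t~φ u u≼t uφ) ,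
    ⊩-stable ψ (λ t t≼s t~ψ → s~~φψ t t≼s λ u u≼t (_ , uψ) → t~ψ u u≼t uψ)
  ⊩-stable (~ φ) s~~~φ t t≼s tφ =
    s~~~φ t t≼s λ u u≼t u~φ → u~φ u ≼-refl (⊩-mono φ u≼t tφ)
  ⊩-stable (all Y φ) s~~∀φ t t≼s = ⊩-stable φ λ u u≼t u~φ →
    -- The projection of `u` forces `~ all Y φ`: a refinement `v` forcing `all Y φ` lifts to a
    -- refinement of `u` forcing `φ`, which is inconsistent and has the same truth as `v`.
    s~~∀φ (push pr₁ u) (≼-trans (push-mono pr₁ u≼t) t≼s) λ v v≼u v∀φ →
      u~φ (lift pr₁ u v≼u) (lift-≼ pr₁ u v≼u) (v∀φ _ (push-lift-≼ pr₁ u v≼u))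
  ⊩-stable (sub f φ) {s} s~~φ = ⊩-stable φ λ t t≼s t~φ →
    s~~φ (lift f s t≼s) (lift-≼ f s t≼s) λ u u≼t uφ →
      t~φ (push f u) (≼-trans (push-mono f u≼t) (push-lift-≼ f s t≼s)) uφ

  -- The Boolean algebras of formulas

  infix 4 _⊑_
  -- As a record it keeps both formulas recoverable from the type, whereas `_⊩_` computes away.
  record _⊑_ {X : Obj} (φ ψ : Form X) : Set ℓ where
    constructor entails
    field
      at : ∀ s → s ⊩ φ → s ⊩ ψ
  open _⊑_

  ⊑-refl : ∀ {X} {φ : Form X} → φ ⊑ φ
  ⊑-refl = entails λ _ sφ → sφ

  ⊑-trans : ∀ {X} {φ ψ χ : Form X} → φ ⊑ ψ → ψ ⊑ χ → φ ⊑ χ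
  ⊑-trans φ⊑ψ ψ⊑χ = entails λ s sφ → at ψ⊑χ s (at φ⊑ψ s sφ)

  formSemilattice : Obj → MeetSemilattice ℓ ℓ ℓ
  formSemilattice X = record
    { Carrier = Form X
    ; _≤_ = _⊑_
    ; _∧_ = _&_
    ; isMeetSemilattice = record
      { isPartialOrder = Interior.isPartialOrder ⊑-refl ⊑-trans
      ; infimum = λ φ ψ → entails (λ _ → proj₁) , entails (λ _ → proj₂) ,
          λ χ χ⊑φ χ⊑ψ → entails λ s sχ → at χ⊑φ s sχ , at χ⊑ψ s sχ
      }
    }

  -- The three rules are, in order, monotonicity of forcing, reflexivity of refinement, and
  -- stability.
  formNegation : ∀ X → InvolutiveNegation (formSemilattice X)
  formNegation X = record
    { ¬_ = ~_
    ; ⊥ = ⊥′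
    ; ¬-intro = λ {φ} φψ⊑⊥ → entails λ s sφ t t≼s tψ → at φψ⊑⊥ t (⊩-mono φ t≼s sφ , tψ)
    ; ¬-elim = λ φ⊑ψ φ⊑~ψ → entails λ s sφ → at φ⊑~ψ s sφ s ≼-refl (at φ⊑ψ s sφ)
    ; ¬¬-elim = λ {φ} → entails λ s → ⊩-stable φ
    }

  private module Formulas (X : Obj) = InvolutiveNegation (formNegation X)
  open Formulas using () renaming (booleanAlgebra to formulas)

  -- Substitution and the doctrine of formulas

  module _ {X′ X : Obj} (f : Hom X′ X) where

    sub-mono : ∀ {φ ψ} → φ ⊑ ψ → sub f φ ⊑ sub f ψ
    sub-mono φ⊑ψ = entails λ s → at φ⊑ψ (push f s)

    substitution : BooleanHomomorphism (formulas X) (formulas X′)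
    substitution = booleanHomomorphism (formulas X) (formulas X′) (sub f)
      (λ (φ⊑ψ , ψ⊑φ) → sub-mono φ⊑ψ , sub-mono ψ⊑φ)
      (λ φ ψ → entails (λ _ s → s) , entails (λ _ s → s))
      -- One direction pushes refinements forward along `f`; the other lifts them back.
      (λ φ → entails (λ s s~φ t t≼s tφ → s~φ (push f t) (push-mono f t≼s) tφ) ,
             entails (λ s s~φ t t≼s tφ → s~φ (lift f s t≼s) (lift-≼ f s t≼s)
                                           (⊩-mono φ (push-lift-≼ f s t≼s) tφ)))

  -- Conditions with the same truth and equal points refine each other, so each functor law reduces
  -- to monotonicity.
  firstOrderHull : BooleanDoctrine C
  firstOrderHull = record
    { F₀ = formulas
    ; F₁ = substitution
    ; F-cong = λ f≈g φ →
        entails (λ s → ⊩-mono φ (strengthen Pred.refl (∘-cong (≈.sym f≈g) ≈.refl))) ,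
        entails (λ s → ⊩-mono φ (strengthen Pred.refl (∘-cong f≈g ≈.refl)))
    ; F-id = λ φ →
        entails (λ s → ⊩-mono φ (strengthen Pred.refl (≈.sym (identityˡ _)))) ,
        entails (λ s → ⊩-mono φ (strengthen Pred.refl (identityˡ _)))
    ; F-∘ = λ f g φ →
        entails (λ s → ⊩-mono φ (strengthen Pred.refl (≈.sym (assoc _ _ _)))) ,
        entails (λ s → ⊩-mono φ (strengthen Pred.refl (assoc _ _ _)))
    }

  -- Quantifiers: adjunction and Beck-Chevalley

  ∀-mono : ∀ {X} Y {φ ψ : Form (X ×ᶜ Y)} → φ ⊑ ψ → all Y φ ⊑ all Y ψ
  ∀-mono Y φ⊑ψ = entails λ s s∀φ t t≼s → at φ⊑ψ t (s∀φ t t≼s)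

  ∀-transpose : ∀ {X} Y {φ : Form X} {ψ : Form (X ×ᶜ Y)} → sub pr₁ φ ⊑ ψ → φ ⊑ all Y ψ
  ∀-transpose Y {φ} φ⊑ψ = entails λ s sφ t t≼s → at φ⊑ψ t (⊩-mono φ t≼s sφ)

  ∀-untranspose : ∀ {X} Y {φ : Form X} {ψ : Form (X ×ᶜ Y)} → φ ⊑ all Y ψ → sub pr₁ φ ⊑ ψ
  ∀-untranspose Y φ⊑∀ψ = entails λ t tφ → at φ⊑∀ψ (push pr₁ t) tφ t ≼-refl

  module _ {X′ X : Obj} (f : Hom X′ X) (Y : Obj) where

    pr₁-×id : ∀ {W} (z : Hom W (X′ ×ᶜ Y)) → pr₁ ∘ᶜ (f ×id Y) ∘ᶜ z ≈ f ∘ᶜ pr₁ ∘ᶜ z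
    pr₁-×id z = ≈.trans (≈.sym (assoc _ _ _))
      (≈.trans (∘-cong (pr₁-β _ _) ≈.refl) (assoc _ _ _))

    pr₂-×id : ∀ {W} (z : Hom W (X′ ×ᶜ Y)) → pr₂ ∘ᶜ (f ×id Y) ∘ᶜ z ≈ pr₂ ∘ᶜ z
    pr₂-×id z = ≈.trans (≈.sym (assoc _ _ _)) (∘-cong (pr₂-β _ _) ≈.refl)

    -- The square of `f ×id Y` and `f` over the projections is a pullback; `⟨ x , pr₂ ∘ᶜ z ⟩` is the
    -- mediating map.
    ×id-pullback : ∀ {W} (x : Hom W X′) (z : Hom W (X ×ᶜ Y)) → pr₁ ∘ᶜ z ≈ f ∘ᶜ x →
                   z ≈ (f ×id Y) ∘ᶜ ⟨ x , pr₂ ∘ᶜ z ⟩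
    ×id-pullback x z z₁≈fx = ≈.trans (⟨⟩-unique _ _ z z₁≈fx ≈.refl) (≈.sym
      (⟨⟩-unique _ _ _ (≈.trans (pr₁-×id _) (∘-cong ≈.refl (pr₁-β _ _)))
                       (≈.trans (pr₂-×id _) (pr₂-β _ _))))

    ∀-sub-⊑ : ∀ φ → sub f (all Y φ) ⊑ all Y (sub (f ×id Y) φ)
    ∀-sub-⊑ φ = entails λ s s∀φ t t≼s → s∀φ (push (f ×id Y) t)
      (≼-trans (strengthen Pred.refl (pr₁-×id _)) (push-mono f t≼s))

    ∀-sub-⊒ : ∀ φ → all Y (sub (f ×id Y) φ) ⊑ sub f (all Y φ)
    ∀-sub-⊒ φ = entails λ { s s∀φ (cond v z) (refine g v≤sg z₁≈fsg) →
      -- The projection of `z` factors as `f ∘ᶜ x`, so the pullback property replaces `z` by a point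
      -- of `X′ ×ᶜ Y` lying over `x`, where the hypothesis applies.
      let x = point s ∘ᶜ g in
      ⊩-mono φ (strengthen Pred.refl (×id-pullback x z (≈.trans z₁≈fsg (assoc _ _ _))))
        (s∀φ (cond v ⟨ x , pr₂ ∘ᶜ z ⟩) (refine g v≤sg (pr₁-β _ _))) }

  isFirstOrder : IsFirstOrder products firstOrderHull
  isFirstOrder = record
    { ∀′ = λ Y X → mkPosetHomo (order (formulas (X ×ᶜ Y))) (order (formulas X)) (all Y)
        λ φ≤ψ → Formulas.≤⇒order X (∀-mono Y (Formulas.order⇒≤ (X ×ᶜ Y) φ≤ψ))
    ; adjoint = λ Y X →
        (λ φ≤ψ → Formulas.≤⇒order X (∀-transpose Y (Formulas.order⇒≤ (X ×ᶜ Y) φ≤ψ))) ,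
        (λ φ≤∀ψ → Formulas.≤⇒order (X ×ᶜ Y) (∀-untranspose Y (Formulas.order⇒≤ X φ≤∀ψ)))
    ; beck-chevalley = λ f Y φ → ∀-sub-⊑ f Y φ , ∀-sub-⊒ f Y φ
    }

  -- The embedding by atoms

  atom-mono : ∀ {X} {α β : ∣P∣ X} → α ≤ β → atom α ⊑ atom β
  atom-mono α≤β = entails λ s s≤α → Pred.trans s≤α ([]-mono (point s) α≤β)

  atom-reflects : ∀ {X} {α β : ∣P∣ X} → atom α ⊑ atom β → α ≤ β
  atom-reflects {α = α} {β} α⊑β = Pred.trans
    (at α⊑β (cond α idᶜ) (Pred.reflexive (Pred.sym ([]-id α))))
    (Pred.reflexive ([]-id β))

  atom-∧ : ∀ {X} (α β : ∣P∣ X) → SymInterior _⊑_ (atom (α Pred.∧ β)) (atom α & atom β)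
  atom-∧ α β =
    entails (λ s s≤αβ → Pred.trans s≤αβ ([]-mono (point s) (Pred.x∧y≤x _ _)) ,
                        Pred.trans s≤αβ ([]-mono (point s) (Pred.x∧y≤y _ _))) ,
    entails (λ s (s≤α , s≤β) → Pred.trans (Pred.∧-greatest s≤α s≤β)
                                 (Pred.reflexive (Pred.sym ([]-∧ (point s) α β))))

  atom-¬ : ∀ {X} (α : ∣P∣ X) → SymInterior _⊑_ (atom (Pred.¬ α)) (~ atom α)
  atom-¬ α =
    entails (λ s s≤¬α t t≼s t≤α → Pred.¬-elim t≤α
      (Pred.trans (⊩-mono (atom (Pred.¬ α)) t≼s s≤¬α) (Pred.reflexive ([]-¬ (point t) α)))) ,
    entails (λ { (cond w x) s~α → Pred.trans
      -- Cutting `w` down to `α [ x ]` gives a refinement that forces `atom α`, so it must be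
      -- inconsistent.
      (Pred.¬-intro (s~α (cond (w Pred.∧ α [ x ]) x)
        (strengthen (Pred.x∧y≤x _ _) ≈.refl) (Pred.x∧y≤y _ _)))
      (Pred.reflexive (Pred.sym ([]-¬ x α))) })

  atomic : NaturalTransformation P firstOrderHull
  atomic = record
    { η = λ X → booleanHomomorphism (P.F₀ X) (formulas X) atom
        (λ α≈β → atom-mono (Pred.reflexive α≈β) , atom-mono (Pred.reflexive (Pred.sym α≈β)))
        atom-∧ atom-¬
    ; natural = λ f α →
        entails (λ s s≤αf → Pred.trans s≤αf (Pred.reflexive (Pred.sym ([]-∘ α ≈.refl)))) ,
        entails (λ s s≤αf → Pred.trans s≤αf (Pred.reflexive ([]-∘ α ≈.refl)))
    }

  atomic-isEmbedding : IsEmbedding atomic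
  atomic-isEmbedding X (α⊑β , β⊑α) = Pred.antisym (atom-reflects α⊑β) (atom-reflects β⊑α)

theorem4p2 : ∀ {ℓ : Level} (C : Category ℓ ℓ ℓ) (products : FiniteProducts C) (P : BooleanDoctrine C) →
    Σ[ H ∈ BooleanDoctrine C ] (IsFirstOrder products H × (Σ[ ι ∈ NaturalTransformation P H ] IsEmbedding ι))
theorem4p2 C products P = firstOrderHull , isFirstOrder , atomic , atomic-isEmbedding
  where open Forcing C products P
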